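{- Let $!_{a}$ be Bhargava's factorial function of the set of prime numbers, given by $0!_{a}=1$ and, for $n\ge1$, $$n!_{a}=\prod_{p}p^{\sum_{m=0}^{\infty}\left\lfloor\frac{n-1}{p^m(p-1)}\right\rfloor},$$ where the (in effect finite) product extends over all primes $p$. Then the number $e_{a}=\sum_{n=0}^{\infty}\frac{1}{n!_{a}}$ (whose approximate numerical value is $2.562760934$) is irrational.
   Context: $\lfloor x\rfloor$ denotes the greatest integer not exceeding $x$. -}

module Defs where

open import Algebra.Properties.Group using (⁻¹-anti-homo-//)
open import Data.Integer.Base as ℤ using (+_)
import Data.Integer.Properties as ℤ
open import Data.List.Base using (applyUpTo)
open import Data.List.Relation.Unary.All.Properties using (applyUpTo⁺₂)
open import Data.Nat.Base as ℕ using (ℕ; zero; suc; _∸_; _^_; NonZero; z≤n; s≤s; z<s)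
open import Data.Nat.DivMod using (m<n⇒m/n≡0; n/1≡n)
open import Data.Nat.ListAction using (product; sum)
open import Data.Nat.ListAction.Properties using (product≢0)
open import Data.Nat.Primality using (Prime; prime?; prime⇒nonZero; ¬prime[0]; ¬prime[1]; prime[2])
import Data.Nat.Properties as ℕ
open import Data.Nat.Tactic.RingSolver using (solve-∀)
open import Data.Product.Base using (∃; _×_; _,_)
open import Data.Rational.Base as ℚ using (ℚ; mkℚ; 0ℚ; _+_; _-_; _<_; _≤_; _/_; ∣_∣; *<*; toℚᵘ)
import Data.Rational.Properties as ℚ
open import Data.Rational.Unnormalised.Base as ℚᵘ using (mkℚᵘ; *≡*; *≤*)
import Data.Rational.Unnormalised.Properties as ℚᵘ
open import Data.Sum.Base using (_⊎_; inj₁; inj₂)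
open import Relation.Binary.PropositionalEquality
open import Relation.Nullary using (¬_; yes; no; contradiction)

-- Real numbers, as Cauchy sequences of rationals up to the equivalence _≃_.

record ℝ : Set where
  field
    seq      : ℕ → ℚ
    isCauchy : ∀ ε → 0ℚ < ε →
               ∃ λ N → ∀ m n → N ℕ.≤ m → N ℕ.≤ n → ∣ seq m - seq n ∣ < ε

open ℝ public

infix 4 _≃_ _<ℝ_ _≈_±_

_≃_ : ℝ → ℝ → Set
x ≃ y = ∀ ε → 0ℚ < ε → ∃ λ N → ∀ n → N ℕ.≤ n → ∣ seq x n - seq y n ∣ < ε

_<ℝ_ : ℝ → ℝ → Set
x <ℝ y = ∃ λ ε → 0ℚ < ε × ∃ λ N → ∀ n → N ℕ.≤ n → seq x n + ε < seq y n

fromℚ : ℚ → ℝ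
fromℚ q = record
  { seq      = λ _ → q
  ; isCauchy = λ ε 0<ε → 0 , λ _ _ _ _ →
      subst (_< ε) (sym (cong ∣_∣ (ℚ.+-inverseʳ q))) 0<ε
  }

-- Strictly within δ of q.
_≈_±_ : ℝ → ℚ → ℚ → Set
x ≈ q ± δ = fromℚ (q - δ) <ℝ x × x <ℝ fromℚ (q + δ)

Irrational : ℝ → Set
Irrational x = ∀ (q : ℚ) → ¬ (x ≃ fromℚ q)

-- Bhargava's factorial of the set of primes is given by its explicit formula
--   n !ₐ = ∏ₚ p ^ Σₘ ⌊ (n − 1) / pᵐ (p − 1) ⌋   for n ≥ 1.
-- The floors are natural number divisions, and the infinite sum and product are
-- cut off at bounds beyond which every term is 0, respectively every factor is 1.

divisor≢0 : ∀ {p} → Prime p → ∀ m → NonZero (p ^ m ℕ.* (p ∸ 1))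
divisor≢0 {zero}        pr m = contradiction pr ¬prime[0]
divisor≢0 {suc zero}    pr m = contradiction pr ¬prime[1]
divisor≢0 {suc (suc k)} pr m = ℕ.m*n≢0 _ _ {{ℕ.m^n≢0 (suc (suc k)) m}}

floorTerm : ∀ {p} → Prime p → (n m : ℕ) → ℕ
floorTerm {p} pr n m = ((n ∸ 1) ℕ./ (p ^ m ℕ.* (p ∸ 1))) {{divisor≢0 pr m}}

exponent : ∀ {p} → Prime p → (M n : ℕ) → ℕ
exponent pr M n = sum (applyUpTo (floorTerm pr n) M)

primeFactor : (M n p : ℕ) → ℕ
primeFactor M n p with prime? p
... | yes pr = p ^ exponent pr M n
... | no  _  = 1

-- The product over the primes p < P, with the exponent of p summed over m < M.
factorialFormula : (P M n : ℕ) → ℕ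
factorialFormula P M n = product (applyUpTo (primeFactor M n) P)

-- Only primes p ≤ n and indices m < n contribute: by factorialFormula-stable
-- below, all larger bounds give the same value.
infix 9 _!ₐ

_!ₐ : ℕ → ℕ
zero      !ₐ = 1
n@(suc _) !ₐ = factorialFormula (suc n) n n

sum-stable : ∀ f {K M} → K ℕ.≤ M → (∀ i → K ℕ.≤ i → f i ≡ 0) →
             sum (applyUpTo f M) ≡ sum (applyUpTo f K)
sum-stable f {zero} {zero}  _ _ = refl
sum-stable f {zero} {suc M} _ f≡0 =
  cong₂ ℕ._+_ (f≡0 0 z≤n) (sum-stable (λ i → f (suc i)) {zero} {M} z≤n λ i _ → f≡0 (suc i) z≤n)
sum-stable f {suc K} {suc M} (s≤s K≤M) f≡0 =
  cong (f 0 ℕ.+_) (sum-stable (λ i → f (suc i)) K≤M λ i K≤i → f≡0 (suc i) (s≤s K≤i))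

product-stable : ∀ f {K M} → K ℕ.≤ M → (∀ i → K ℕ.≤ i → f i ≡ 1) →
                 product (applyUpTo f M) ≡ product (applyUpTo f K)
product-stable f {zero} {zero}  _ _ = refl
product-stable f {zero} {suc M} _ f≡1 =
  cong₂ ℕ._*_ (f≡1 0 z≤n) (product-stable (λ i → f (suc i)) {zero} {M} z≤n λ i _ → f≡1 (suc i) z≤n)
product-stable f {suc K} {suc M} (s≤s K≤M) f≡1 =
  cong (f 0 ℕ.*_) (product-stable (λ i → f (suc i)) K≤M λ i K≤i → f≡1 (suc i) (s≤s K≤i))

product-cong : ∀ {f g} M → (∀ i → f i ≡ g i) →
               product (applyUpTo f M) ≡ product (applyUpTo g M)
product-cong zero    f≡g = refl
product-cong (suc M) f≡g = cong₂ ℕ._*_ (f≡g 0) (product-cong M λ i → f≡g (suc i))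

n<2^n : ∀ n → n ℕ.< 2 ^ n
n<2^n zero    = z<s
n<2^n (suc n) = begin-strict
  suc n                 ≡⟨ ℕ.+-comm 1 n ⟩
  n ℕ.+ 1               <⟨ ℕ.+-mono-<-≤ (n<2^n n) (ℕ.m^n>0 2 n) ⟩
  2 ^ n ℕ.+ 2 ^ n       ≡⟨ cong (2 ^ n ℕ.+_) (ℕ.+-identityʳ (2 ^ n)) ⟨
  2 ^ suc n             ∎
  where open ℕ.≤-Reasoning

floorTerm≡0 : ∀ {p} (pr : Prime p) n m → n ∸ 1 ℕ.< p ^ m ℕ.* (p ∸ 1) → floorTerm pr n m ≡ 0
floorTerm≡0 pr n m = m<n⇒m/n≡0 {{divisor≢0 pr m}}

floorTerm-large-m : ∀ {p} (pr : Prime p) n m → suc n ℕ.≤ m → floorTerm pr (suc n) m ≡ 0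
floorTerm-large-m {zero}          pr n m n<m = contradiction pr ¬prime[0]
floorTerm-large-m {suc zero}      pr n m n<m = contradiction pr ¬prime[1]
floorTerm-large-m {p@(suc (suc k))} pr n m n<m = floorTerm≡0 pr (suc n) m (begin-strict
  n                   <⟨ n<m ⟩
  m                   <⟨ n<2^n m ⟩
  2 ^ m               ≤⟨ ℕ.^-monoˡ-≤ m (s≤s (s≤s z≤n)) ⟩
  p ^ m               ≤⟨ ℕ.m≤m*n (p ^ m) (p ∸ 1) ⟩
  p ^ m ℕ.* (p ∸ 1)   ∎)
  where open ℕ.≤-Reasoning

floorTerm-large-p : ∀ {p} (pr : Prime p) n m → suc n ℕ.< p → floorTerm pr (suc n) m ≡ 0
floorTerm-large-p {p@(suc q)} pr n m (s≤s n<q) = floorTerm≡0 pr (suc n) m (begin-strict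
  n                   <⟨ n<q ⟩
  q                   ≤⟨ ℕ.m≤n*m q (p ^ m) {{ℕ.m^n≢0 p m}} ⟩
  p ^ m ℕ.* q         ∎)
  where open ℕ.≤-Reasoning

primeFactor≡1 : ∀ M n p → suc n ℕ.< p → primeFactor M (suc n) p ≡ 1
primeFactor≡1 M n p n<p with prime? p
... | yes pr = cong (p ^_) (sum-stable (floorTerm pr (suc n)) {0} {M} z≤n
                 λ m _ → floorTerm-large-p pr n m n<p)
... | no  _  = refl

primeFactor-stable : ∀ M n → suc n ℕ.≤ M → ∀ p →
                     primeFactor M (suc n) p ≡ primeFactor (suc n) (suc n) p
primeFactor-stable M n n<M p with prime? p
... | yes pr = cong (p ^_) (sum-stable (floorTerm pr (suc n)) n<M (floorTerm-large-m pr n))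
... | no  _  = refl

primeFactor≢0 : ∀ M n p → NonZero (primeFactor M n p)
primeFactor≢0 M n p with prime? p
... | yes pr = ℕ.m^n≢0 p (exponent pr M n) {{prime⇒nonZero pr}}
... | no  _  = _

factorialFormula-stable : ∀ n .{{_ : NonZero n}} {P M} → n ℕ.< P → n ℕ.≤ M →
                          factorialFormula P M n ≡ n !ₐ
factorialFormula-stable n@(suc n-1) {P} {M} n<P n≤M = trans
  (product-stable (primeFactor M n) n<P λ p n<p → primeFactor≡1 M n-1 p n<p)
  (product-cong (suc n) (primeFactor-stable M n-1 n≤M))

n!ₐ≢0 : ∀ n → NonZero (n !ₐ)
n!ₐ≢0 zero      = _
n!ₐ≢0 n@(suc _) = product≢0 (applyUpTo⁺₂ (primeFactor n n) (suc n) (primeFactor≢0 n n))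

partialSum : ℕ → ℚ
partialSum zero    = 0ℚ
partialSum (suc n) = partialSum n + (+ 1 / (n !ₐ)) {{n!ₐ≢0 n}}

2^n≤[1+n]!ₐ : ∀ n → 2 ^ n ℕ.≤ suc n !ₐ
2^n≤[1+n]!ₐ zero        = ℕ.>-nonZero⁻¹ (1 !ₐ) {{n!ₐ≢0 1}}
2^n≤[1+n]!ₐ n@(suc n-1) = begin
  2 ^ n                                ≡⟨ cong (2 ^_) (n/1≡n n) ⟨
  2 ^ (n ℕ./ 1)                        ≤⟨ ℕ.^-monoʳ-≤ 2 (ℕ.m≤m+n (n ℕ./ 1) e) ⟩
  2 ^ (n ℕ./ 1 ℕ.+ e)                  ≤⟨ ℕ.m≤m*n _ rest {{rest≢0}} ⟩
  2 ^ (n ℕ./ 1 ℕ.+ e) ℕ.* rest         ≡⟨ ℕ.*-identityˡ _ ⟨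
  1 ℕ.* (2 ^ (n ℕ./ 1 ℕ.+ e) ℕ.* rest) ≡⟨ ℕ.*-identityˡ _ ⟨
  suc n !ₐ                             ∎
  where
  open ℕ.≤-Reasoning
  e    = sum (applyUpTo (λ m → floorTerm prime[2] (suc n) (suc m)) n)
  f    = λ i → primeFactor (suc n) (suc n) (3 ℕ.+ i)
  rest = product (applyUpTo f n-1)
  rest≢0 : NonZero rest
  rest≢0 = product≢0 (applyUpTo⁺₂ f n-1 λ i → primeFactor≢0 (suc n) (suc n) (3 ℕ.+ i))

toℚᵘ-/ : ∀ d .{{_ : NonZero d}} → toℚᵘ (+ 1 / d) ℚᵘ.≃ (+ 1 ℚᵘ./ d)
toℚᵘ-/ (suc d-1) = ℚ.toℚᵘ-fromℚᵘ (mkℚᵘ (+ 1) d-1)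

1/-anti : ∀ {a b} .{{_ : NonZero a}} .{{_ : NonZero b}} → a ℕ.≤ b → + 1 / b ≤ + 1 / a
1/-anti {a@(suc _)} {b@(suc _)} a≤b = ℚ.toℚᵘ-cancel-≤ (begin
  toℚᵘ (+ 1 / b)  ≃⟨ toℚᵘ-/ b ⟩
  + 1 ℚᵘ./ b      ≤⟨ *≤* (ℤ.*-monoˡ-≤-nonNeg (+ 1) (ℤ.+≤+ a≤b)) ⟩
  + 1 ℚᵘ./ a      ≃⟨ toℚᵘ-/ a ⟨
  toℚᵘ (+ 1 / a)  ∎)
  where open ℚᵘ.≤-Reasoning

1/-double : ∀ a .{{_ : NonZero a}} .{{_ : NonZero (2 ℕ.* a)}} →
            + 1 / (2 ℕ.* a) + + 1 / (2 ℕ.* a) ≡ + 1 / a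
1/-double a@(suc _) = ℚ.toℚᵘ-injective (begin
  toℚᵘ (h + h)                          ≈⟨ ℚ.toℚᵘ-homo-+ h h ⟩
  toℚᵘ h ℚᵘ.+ toℚᵘ h                    ≈⟨ ℚᵘ.+-cong (toℚᵘ-/ (2 ℕ.* a)) (toℚᵘ-/ (2 ℕ.* a)) ⟩
  (+ 1 ℚᵘ./ (2 ℕ.* a)) ℚᵘ.+ (+ 1 ℚᵘ./ (2 ℕ.* a))
                                        ≈⟨ *≡* (cong +_ (arith a)) ⟩
  + 1 ℚᵘ./ a                            ≈⟨ toℚᵘ-/ a ⟨
  toℚᵘ (+ 1 / a)                        ∎)
  where
  open import Relation.Binary.Reasoning.Setoid ℚᵘ.≃-setoid
  h = + 1 / (2 ℕ.* a)
  arith : ∀ a → (1 ℕ.* (2 ℕ.* a) ℕ.+ 1 ℕ.* (2 ℕ.* a)) ℕ.* a ≡ 1 ℕ.* ((2 ℕ.* a) ℕ.* (2 ℕ.* a))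
  arith = solve-∀

1/-anti-< : ∀ {a b} .{{_ : NonZero a}} .{{_ : NonZero b}} → a ℕ.< b → + 1 / b < + 1 / a
1/-anti-< {a@(suc _)} {b@(suc _)} a<b = ℚ.toℚᵘ-cancel-< (begin-strict
  toℚᵘ (+ 1 / b)  ≃⟨ toℚᵘ-/ b ⟩
  + 1 ℚᵘ./ b      <⟨ ℚᵘ.*<* (ℤ.*-monoˡ-<-pos (+ 1) (ℤ.+<+ a<b)) ⟩
  + 1 ℚᵘ./ a      ≃⟨ toℚᵘ-/ a ⟨
  toℚᵘ (+ 1 / a)  ∎)
  where open ℚᵘ.≤-Reasoning

1/≤pos : ∀ ε → 0ℚ < ε → + 1 / ℚ.↧ₙ ε ≤ ε
1/≤pos ε@(mkℚ (+ suc a) d-1 _) 0<ε = ℚ.toℚᵘ-cancel-≤ (begin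
  toℚᵘ (+ 1 / suc d-1)  ≃⟨ toℚᵘ-/ (suc d-1) ⟩
  mkℚᵘ (+ 1) d-1        ≤⟨ *≤* (ℤ.*-monoʳ-≤-nonNeg (+ suc d-1) (ℤ.+≤+ (s≤s (z≤n {a})))) ⟩
  mkℚᵘ (+ suc a) d-1    ∎)
  where open ℚᵘ.≤-Reasoning
1/≤pos (mkℚ (+ zero) _ _)   (*<* (ℤ.+<+ ()))
1/≤pos (mkℚ ℤ.-[1+ _ ] _ _) (*<* ())

∣-∣≤ : ∀ {l r x y} → l ≤ x → x ≤ l + r → l ≤ y → y ≤ l + r → ∣ x - y ∣ ≤ r
∣-∣≤ {l} {r} {x} {y} l≤x x≤u l≤y y≤u = bound (ℚ.∣p∣≡p∨∣p∣≡-p (x - y))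
  where
  diff : ∀ {x y} → x ≤ l + r → l ≤ y → x - y ≤ r
  diff {x} {y} x≤u l≤y = begin
    x - y            ≤⟨ ℚ.+-mono-≤ x≤u (ℚ.neg-antimono-≤ l≤y) ⟩
    l + r - l        ≡⟨ ℚ.+-comm (l + r) (ℚ.- l) ⟩
    ℚ.- l + (l + r)  ≡⟨ ℚ.+-assoc (ℚ.- l) l r ⟨
    ℚ.- l + l + r    ≡⟨ cong (_+ r) (ℚ.+-inverseˡ l) ⟩
    0ℚ + r           ≡⟨ ℚ.+-identityˡ r ⟩
    r                ∎
    where open ℚ.≤-Reasoning

  bound : ∣ x - y ∣ ≡ x - y ⊎ ∣ x - y ∣ ≡ ℚ.- (x - y) → ∣ x - y ∣ ≤ r
  bound (inj₁ eq) = subst (_≤ r) (sym eq) (diff x≤u l≤y)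
  bound (inj₂ eq) = subst (_≤ r) (sym (trans eq (⁻¹-anti-homo-// ℚ.+-0-group x y))) (diff y≤u l≤x)

1/2^ : ℕ → ℚ
1/2^ n = (+ 1 / 2 ^ n) {{ℕ.m^n≢0 2 n}}

1/2^-double : ∀ n → 1/2^ (suc n) + 1/2^ (suc n) ≡ 1/2^ n
1/2^-double n = 1/-double (2 ^ n) {{ℕ.m^n≢0 2 n}} {{ℕ.m^n≢0 2 (suc n)}}

term≤ : ∀ n → (+ 1 / (suc n !ₐ)) {{n!ₐ≢0 (suc n)}} ≤ 1/2^ n
term≤ n = 1/-anti {{ℕ.m^n≢0 2 n}} {{n!ₐ≢0 (suc n)}} (2^n≤[1+n]!ₐ n)

0≤term : ∀ n → 0ℚ ≤ (+ 1 / (n !ₐ)) {{n!ₐ≢0 n}}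
0≤term n = ℚ.nonNegative⁻¹ _ {{ℚ.normalize-nonNeg 1 (n !ₐ) {{n!ₐ≢0 n}}}}

0≤1/2^ : ∀ n → 0ℚ ≤ 1/2^ n
0≤1/2^ n = ℚ.nonNegative⁻¹ _ {{ℚ.normalize-nonNeg 1 (2 ^ n) {{ℕ.m^n≢0 2 n}}}}

p≤p+q : ∀ p {q} → 0ℚ ≤ q → p ≤ p + q
p≤p+q p {q} 0≤q = subst (_≤ p + q) (ℚ.+-identityʳ p) (ℚ.+-monoʳ-≤ p 0≤q)

partialSum-mono : ∀ {m n} → m ℕ.≤′ n → partialSum m ≤ partialSum n
partialSum-mono ℕ.≤′-refl               = ℚ.≤-refl
partialSum-mono (ℕ.≤′-step {n} m≤n) = ℚ.≤-trans (partialSum-mono m≤n) (p≤p+q _ (0≤term n))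

upper : ℕ → ℚ
upper n = partialSum (suc n) + (1/2^ n + 1/2^ n)

upper-step : ∀ n → upper (suc n) ≤ upper n
upper-step n = begin
  partialSum (suc n) + t + (1/2^ (suc n) + 1/2^ (suc n)) ≡⟨ cong (λ h → partialSum (suc n) + t + h) (1/2^-double n) ⟩
  partialSum (suc n) + t + 1/2^ n                        ≡⟨ ℚ.+-assoc (partialSum (suc n)) t _ ⟩
  partialSum (suc n) + (t + 1/2^ n)
    ≤⟨ ℚ.+-monoʳ-≤ (partialSum (suc n)) (ℚ.+-monoˡ-≤ (1/2^ n) (term≤ n)) ⟩
  partialSum (suc n) + (1/2^ n + 1/2^ n)                 ∎
  where
  open ℚ.≤-Reasoning
  t = (+ 1 / (suc n !ₐ)) {{n!ₐ≢0 (suc n)}}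

upper-anti : ∀ {m n} → m ℕ.≤′ n → upper n ≤ upper m
upper-anti ℕ.≤′-refl            = ℚ.≤-refl
upper-anti (ℕ.≤′-step {n} m≤n) = ℚ.≤-trans (upper-step n) (upper-anti m≤n)

partialSum≤ : ∀ {N n} → suc (suc N) ℕ.≤ n → partialSum n ≤ partialSum (suc (suc N)) + 1/2^ N
partialSum≤ {N} {suc n} (s≤s N<n) = begin
  partialSum (suc n)               ≤⟨ p≤p+q _ (ℚ.+-mono-≤ (0≤1/2^ n) (0≤1/2^ n)) ⟩
  upper n                          ≤⟨ upper-anti (ℕ.≤⇒≤′ N<n) ⟩
  upper (suc N)                    ≡⟨ cong (λ h → partialSum (suc (suc N)) + h) (1/2^-double N) ⟩
  partialSum (suc (suc N)) + 1/2^ N ∎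
  where open ℚ.≤-Reasoning

partialSum-isCauchy : ∀ ε → 0ℚ < ε →
  ∃ λ N → ∀ m n → N ℕ.≤ m → N ℕ.≤ n → ∣ partialSum m - partialSum n ∣ < ε
partialSum-isCauchy ε 0<ε = suc (suc d) , λ m n N≤m N≤n → begin-strict
  ∣ partialSum m - partialSum n ∣
    ≤⟨ ∣-∣≤ (partialSum-mono (ℕ.≤⇒≤′ N≤m)) (partialSum≤ N≤m)
            (partialSum-mono (ℕ.≤⇒≤′ N≤n)) (partialSum≤ N≤n) ⟩
  1/2^ d     <⟨ 1/-anti-< {{_}} {{ℕ.m^n≢0 2 d}} (n<2^n d) ⟩
  + 1 / d    ≤⟨ 1/≤pos ε 0<ε ⟩
  ε          ∎
  where
  open ℚ.≤-Reasoning
  d = ℚ.↧ₙ ε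

eₐ : ℝ
eₐ = record { seq = partialSum ; isCauchy = partialSum-isCauchy }

{-# OPTIONS --safe #-}
-- Write aₙ = n !ₐ and Sₙ = ∑_{i<n} 1/aᵢ.  Each aₙ divides aₙ₊₁, and the exponent of 2
-- alone shows that 2ᵏ ∣ n forces 2ᵏ⁺¹ aₙ ∣ aₙ₊₁.  In particular aₙ₊₁ ≥ 2 aₙ for n ≥ 1, so
-- the bounds Sₙ + 2/aₙ decrease and eₐ lies between Sₙ₊₁ and Sₙ₊₁ + 2/aₙ₊₁.  If eₐ = s/t,
-- take n = 2ᵗ: then 2/aₙ₊₁ < 1/(t aₙ), while aₙ Sₙ₊₁ is an integer T, so that s aₙ lies
-- strictly between the consecutive integers T t and T t + 1.
module Submission where

open import Algebra.Properties.Group using (⁻¹-anti-homo-//)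
open import Data.Integer.Base as ℤ using (+_)
import Data.Integer.Properties as ℤ
open import Data.List.Base using (applyUpTo)
open import Data.Nat.Base as ℕ using (ℕ; zero; suc; _*_; _^_; _∸_; NonZero; z≤n; s≤s; z<s)
open import Data.Nat.Divisibility using (_∣_; divides; 1∣_; ∣-refl; ∣-trans; ∣⇒≤; *-pres-∣; *-monoʳ-∣)
open import Data.Nat.DivMod using (m<n*o⇒m/o<n; m*n/n≡m; /-monoˡ-≤)
open import Data.Nat.ListAction using (product; sum)
open import Data.Nat.Primality using (Prime; prime?; prime[2])
import Data.Nat.Properties as ℕ
open import Data.Nat.Tactic.RingSolver using (solve-∀)
open import Data.Product.Base using (∃; _×_; _,_)
open import Data.Rational.Base as ℚ using (ℚ; 0ℚ; _/_; _+_; _-_; _<_; _≤_; ∣_∣; toℚᵘ; ↧ₙ_)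
import Data.Rational.Properties as ℚ
open import Data.Rational.Unnormalised.Base as ℚᵘ using (*≡*; *<*)
import Data.Rational.Unnormalised.Properties as ℚᵘ
open import Data.Sum.Base using (inj₁; inj₂)
open import Relation.Binary.PropositionalEquality
open import Relation.Nullary using (¬_; yes; no)
open import Relation.Nullary.Decidable using (toWitness)
open import Defs

-- Divisibility between consecutive factorials.

^-monoʳ-∣ : ∀ p {m n} → m ℕ.≤ n → p ^ m ∣ p ^ n
^-monoʳ-∣ p z≤n       = 1∣ _
^-monoʳ-∣ p (s≤s m≤n) = *-monoʳ-∣ p (^-monoʳ-∣ p m≤n)

product-mono-∣ : ∀ {f g} → (∀ i → f i ∣ g i) → ∀ M →
                 product (applyUpTo f M) ∣ product (applyUpTo g M)
product-mono-∣ f∣g zero    = ∣-refl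
product-mono-∣ f∣g (suc M) = *-pres-∣ (f∣g 0) (product-mono-∣ (λ i → f∣g (suc i)) M)

-- Each strict inequality among the first `K` terms is worth at least one. Applied to exponents,
-- `K = 0` gives divisibility of prime powers and larger `K` gives `K` extra factors.
sum-gain : ∀ {f g K M} → K ℕ.≤ M → (∀ i → f i ℕ.≤ g i) → (∀ i → i ℕ.< K → f i ℕ.< g i) →
           K ℕ.+ sum (applyUpTo f M) ℕ.≤ sum (applyUpTo g M)
sum-gain {M = zero}  z≤n f≤g _ = z≤n
sum-gain {M = suc M} z≤n f≤g _ =
  ℕ.+-mono-≤ (f≤g 0) (sum-gain {M = M} z≤n (λ i → f≤g (suc i)) λ _ ())
sum-gain {f} {g} {suc K} {suc M} (s≤s K≤M) f≤g f<g = begin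
  suc K ℕ.+ (f 0 ℕ.+ s)    ≡⟨ shift K (f 0) s ⟩
  suc (f 0) ℕ.+ (K ℕ.+ s)  ≤⟨ ℕ.+-mono-≤ (f<g 0 z<s)
                                (sum-gain K≤M (λ i → f≤g (suc i)) λ i i<K → f<g (suc i) (s≤s i<K)) ⟩
  sum (applyUpTo g (suc M)) ∎
  where
  open ℕ.≤-Reasoning
  s = sum (applyUpTo (λ i → f (suc i)) M)
  shift : ∀ a b c → suc a ℕ.+ (b ℕ.+ c) ≡ suc b ℕ.+ (a ℕ.+ c)
  shift = solve-∀

floorTerm-mono : ∀ {p} (pr : Prime p) {m n} → m ℕ.≤ n → ∀ i → floorTerm pr m i ℕ.≤ floorTerm pr n i
floorTerm-mono pr m≤n i = /-monoˡ-≤ _ {{divisor≢0 pr i}} (ℕ.∸-monoˡ-≤ 1 m≤n)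

primeFactor-mono-∣ : ∀ M {m n} → m ℕ.≤ n → ∀ p → primeFactor M m p ∣ primeFactor M n p
primeFactor-mono-∣ M m≤n p with prime? p
... | yes pr = ^-monoʳ-∣ p (sum-gain {K = 0} {M} z≤n (floorTerm-mono pr m≤n) λ _ ())
... | no  _  = ∣-refl

m∸1/d<m/d : ∀ {m d} .{{_ : NonZero m}} .{{_ : NonZero d}} → d ∣ m → (m ∸ 1) ℕ./ d ℕ.< m ℕ./ d
m∸1/d<m/d {m} {d} (divides q refl) =
  subst ((m ∸ 1) ℕ./ d ℕ.<_) (sym (m*n/n≡m q d)) (m<n*o⇒m/o<n (ℕ.≤-reflexive (ℕ.suc-pred m)))

-- For the prime 2 the divisors in the floors are the powers `2 ^ i`. Those with `i ≤ k` divide `n`,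
-- so each of these `suc k` floors jumps when its numerator passes from `n ∸ 1` to `n`.
primeFactor-two : ∀ {M} n k .{{_ : NonZero n}} → 2 ^ k ∣ n → suc k ℕ.≤ M →
                  2 ^ suc k * primeFactor M n 2 ∣ primeFactor M (suc n) 2
primeFactor-two {M} n k {{n≢0}} 2^k∣n k<M =
  subst (_∣ primeFactor M (suc n) 2) (ℕ.^-distribˡ-+-* 2 (suc k) (exponent prime[2] M n))
    (^-monoʳ-∣ 2 (sum-gain k<M (floorTerm-mono prime[2] (ℕ.n≤1+n n)) λ i i≤k →
      m∸1/d<m/d {{n≢0}} {{divisor≢0 prime[2] i}} (2^i*1∣n i i≤k)))
  where
  2^i*1∣n : ∀ i → i ℕ.< suc k → 2 ^ i * 1 ∣ n
  2^i*1∣n i (s≤s i≤k) = subst (_∣ n) (sym (ℕ.*-identityʳ (2 ^ i))) (∣-trans (^-monoʳ-∣ 2 i≤k) 2^k∣n)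

2^[1+k]*n!ₐ∣[1+n]!ₐ : ∀ n k .{{_ : NonZero n}} → 2 ^ k ∣ n → 2 ^ suc k * n !ₐ ∣ suc n !ₐ
2^[1+k]*n!ₐ∣[1+n]!ₐ n k 2^k∣n = subst₂ (λ a b → 2 ^ suc k * a ∣ b)
  (factorialFormula-stable n (ℕ.m≤n+m (suc n) 2) (ℕ.m≤m+n n (suc k)))
  (factorialFormula-stable (suc n) (ℕ.n≤1+n (2 ℕ.+ n))
    (ℕ.≤-trans (ℕ.m≤m+n (suc n) k) (ℕ.≤-reflexive (sym (ℕ.+-suc n k)))))
  -- With common cutoffs the products compare factor by factor: indices 0 and 1 contribute 1, index
  -- 2 supplies the power of 2, and the others only need monotonicity.
  (subst (_∣ factorialFormula (3 ℕ.+ n) M (suc n)) (pull (2 ^ suc k) (primeFactor M n 2) _)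
    (*-monoʳ-∣ 1 (*-monoʳ-∣ 1 (*-pres-∣
      (primeFactor-two n k 2^k∣n (ℕ.m≤n+m (suc k) n))
      (product-mono-∣ (λ i → primeFactor-mono-∣ M (ℕ.n≤1+n n) (3 ℕ.+ i)) n)))))
  where
  -- Large enough for both factorials and for the `suc k` floors that jump.
  M = n ℕ.+ suc k
  pull : ∀ c x y → 1 * (1 * (c * x * y)) ≡ c * (1 * (1 * (x * y)))
  pull = solve-∀

n!ₐ∣[1+n]!ₐ : ∀ n → n !ₐ ∣ suc n !ₐ
n!ₐ∣[1+n]!ₐ zero    = 1∣ _
n!ₐ∣[1+n]!ₐ (suc n) = ∣-trans (divides 2 refl) (2^[1+k]*n!ₐ∣[1+n]!ₐ (suc n) 0 (1∣ _))

-- Bounds for the tail of the series.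

1/_!ₐ : ℕ → ℚ
1/ n !ₐ = (+ 1 / (n !ₐ)) {{n!ₐ≢0 n}}

-- The tail from index n on is at most (1/aₙ)(1 + 1/2 + 1/4 + ⋯) = 2/aₙ.
tailBound : ℕ → ℚ
tailBound n = partialSum n + (1/ n !ₐ + 1/ n !ₐ)

-- The case `k = 0` makes the factorial at least double, so two copies of the next reciprocal fit
-- into one copy of the current one. At `n = 0` this would fail, since the factorials of 0 and 1 are
-- both 1.
tailBound-step : ∀ n .{{_ : NonZero n}} → tailBound (suc n) ≤ tailBound n
tailBound-step n = begin
  partialSum n + 1/ n !ₐ + (1/ suc n !ₐ + 1/ suc n !ₐ)
    ≤⟨ ℚ.+-monoʳ-≤ (partialSum (suc n)) (ℚ.+-mono-≤ t≤h t≤h) ⟩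
  partialSum n + 1/ n !ₐ + (h + h)
    ≡⟨ cong (partialSum (suc n) ℚ.+_) (1/-double (n !ₐ) {{n!ₐ≢0 n}} {{2a≢0}}) ⟩
  partialSum n + 1/ n !ₐ + 1/ n !ₐ
    ≡⟨ ℚ.+-assoc (partialSum n) _ _ ⟩
  tailBound n ∎
  where
  open ℚ.≤-Reasoning
  2a≢0 : NonZero (2 * n !ₐ)
  2a≢0 = ℕ.m*n≢0 2 (n !ₐ) {{_}} {{n!ₐ≢0 n}}
  h = (+ 1 / (2 * n !ₐ)) {{2a≢0}}
  t≤h : 1/ suc n !ₐ ≤ h
  t≤h = 1/-anti {{2a≢0}} {{n!ₐ≢0 (suc n)}}
          (∣⇒≤ {{n!ₐ≢0 (suc n)}} (2^[1+k]*n!ₐ∣[1+n]!ₐ n 0 (1∣ n)))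

partialSum≤tailBound : ∀ {m n} .{{_ : NonZero m}} → m ℕ.≤ n → partialSum n ≤ tailBound m
partialSum≤tailBound {m} {n} m≤n =
  ℚ.≤-trans (p≤p+q _ (ℚ.+-mono-≤ (0≤term n) (0≤term n))) (anti (ℕ.≤⇒≤′ m≤n))
  where
  anti : ∀ {n} → m ℕ.≤′ n → tailBound n ≤ tailBound m
  anti ℕ.≤′-refl           = ℚ.≤-refl
  anti (ℕ.≤′-step {n} m≤n) = ℚ.≤-trans
    (tailBound-step n {{ℕ.>-nonZero (ℕ.≤-trans (ℕ.>-nonZero⁻¹ m) (ℕ.≤′⇒≤ m≤n))}}) (anti m≤n)

-- Passing bounds to a rational limit.

p≤∣p∣ : ∀ p → p ≤ ∣ p ∣
p≤∣p∣ p with ℚ.≤-total 0ℚ p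
... | inj₁ 0≤p = ℚ.≤-reflexive (sym (ℚ.0≤p⇒∣p∣≡p 0≤p))
... | inj₂ p≤0 = ℚ.≤-trans p≤0 (ℚ.0≤∣p∣ p)

∣p-q∣≡∣q-p∣ : ∀ p q → ∣ p - q ∣ ≡ ∣ q - p ∣
∣p-q∣≡∣q-p∣ p q = trans (sym (ℚ.∣-p∣≡∣p∣ (p - q))) (cong ∣_∣ (⁻¹-anti-homo-// ℚ.+-0-group p q))

p<q⇒0<q-p : ∀ {p q} → p < q → 0ℚ < q - p
p<q⇒0<q-p {p} {q} p<q = subst (_< q - p) (ℚ.+-inverseʳ p) (ℚ.+-monoˡ-< (ℚ.- p) p<q)

-- If `q < l`, the gap `l - q` serves as tolerance, and an index past both thresholds gives a
-- contradiction.
≃-lower : ∀ x {l q N} → (∀ n → N ℕ.≤ n → l ≤ seq x n) → x ≃ fromℚ q → l ≤ q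
≃-lower x {l} {q} {N} l≤x x≃q = ℚ.≮⇒≥ λ q<l →
  let K , close = x≃q (l - q) (p<q⇒0<q-p q<l)
      n = N ℕ.⊔ K
  in ℚ.<-irrefl refl (begin-strict
    l - q            ≤⟨ ℚ.+-monoˡ-≤ (ℚ.- q) (l≤x n (ℕ.m≤m⊔n N K)) ⟩
    seq x n - q      ≤⟨ p≤∣p∣ _ ⟩
    ∣ seq x n - q ∣  <⟨ close n (ℕ.m≤n⊔m N K) ⟩
    l - q            ∎)
  where open ℚ.≤-Reasoning

≃-upper : ∀ x {u q N} → (∀ n → N ℕ.≤ n → seq x n ≤ u) → x ≃ fromℚ q → q ≤ u
≃-upper x {u} {q} {N} x≤u x≃q = ℚ.≮⇒≥ λ u<q →
  let K , close = x≃q (q - u) (p<q⇒0<q-p u<q)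
      n = N ℕ.⊔ K
  in ℚ.<-irrefl refl (begin-strict
    q - u            ≤⟨ ℚ.+-monoʳ-≤ q (ℚ.neg-antimono-≤ (x≤u n (ℕ.m≤m⊔n N K))) ⟩
    q - seq x n      ≤⟨ p≤∣p∣ _ ⟩
    ∣ q - seq x n ∣  ≡⟨ ∣p-q∣≡∣q-p∣ q (seq x n) ⟩
    ∣ seq x n - q ∣  <⟨ close n (ℕ.m≤n⊔m N K) ⟩
    q - u            ∎)
  where open ℚ.≤-Reasoning

-- Common denominators.

-- Used twice: with `r` the quotient of consecutive factorials when a term is added, and with `r`
-- the denominator of `q` for the right end of the forbidden interval.
fraction-+ : ∀ x T r a .{{_ : NonZero a}} .{{_ : NonZero (r * a)}} → toℚᵘ x ℚᵘ.≃ (+ T ℚᵘ./ a) →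
             toℚᵘ (x + + 1 / (r * a)) ℚᵘ.≃ (+ suc (T * r) ℚᵘ./ (r * a))
fraction-+ x T zero    a@(suc _) {{_}} {{()}} _
fraction-+ x T r@(suc _) a@(suc _) x≃T/a = begin
  toℚᵘ (x + + 1 / (r * a))               ≈⟨ ℚ.toℚᵘ-homo-+ x (+ 1 / (r * a)) ⟩
  toℚᵘ x ℚᵘ.+ toℚᵘ (+ 1 / (r * a))       ≈⟨ ℚᵘ.+-cong x≃T/a (toℚᵘ-/ (r * a)) ⟩
  (+ T ℚᵘ./ a) ℚᵘ.+ (+ 1 ℚᵘ./ (r * a))   ≈⟨ *≡* cross ⟩
  (+ suc (T * r) ℚᵘ./ (r * a))           ∎
  where
  open import Relation.Binary.Reasoning.Setoid ℚᵘ.≃-setoid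
  arith : ∀ T r a → (T * (r * a) ℕ.+ 1 * a) * (r * a) ≡ suc (T * r) * (a * (r * a))
  arith = solve-∀
  cross : (+ T ℤ.* + (r * a) ℤ.+ + (1 * a)) ℤ.* + (r * a) ≡ + (suc (T * r) * (a * (r * a)))
  cross = trans (cong (λ z → (z ℤ.+ + (1 * a)) ℤ.* + (r * a)) (sym (ℤ.pos-* T (r * a))))
         (trans (sym (ℤ.pos-* (T * (r * a) ℕ.+ 1 * a) (r * a))) (cong +_ (arith T r a)))

partialSum-fraction : ∀ n → ∃ λ T → toℚᵘ (partialSum (suc n)) ℚᵘ.≃ (+ T ℚᵘ./ (n !ₐ)) {{n!ₐ≢0 n}}
partialSum-fraction zero    = 1 , *≡* refl
partialSum-fraction (suc n) with partialSum-fraction n | suc n !ₐ | n!ₐ≢0 (suc n) | n!ₐ∣[1+n]!ₐ n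
... | T , eq | .(r * n !ₐ) | r*a≢0 | divides r refl =
  suc (T * r) , fraction-+ (partialSum (suc n)) T r (n !ₐ) {{n!ₐ≢0 n}} {{r*a≢0}} eq

no-fraction-between : ∀ x T a (q : ℚ) .{{_ : NonZero a}} .{{_ : NonZero (↧ₙ q * a)}} →
  toℚᵘ x ℚᵘ.≃ (+ T ℚᵘ./ a) → x < q → ¬ (q < x + + 1 / (↧ₙ q * a))
no-fraction-between x T a@(suc _) q@(ℚ.mkℚ s t-1 _) x≃T/a x<q q<x+1/ta =
  ℤ.<⇒≱ sa<1+Tt (ℤ.i<j⇒suc[i]≤j Tt<sa)
  where
  t = suc t-1
  Tt<sa : + (T * t) ℤ.< s ℤ.* + a
  Tt<sa = subst (ℤ._< s ℤ.* + a) (sym (ℤ.pos-* T t))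
    (ℚᵘ.drop-*<* (ℚᵘ.<-respˡ-≃ x≃T/a (ℚ.toℚᵘ-mono-< x<q)))
  -- Cross-multiplying the upper inequality leaves a factor `t` on both sides; it is isolated here
  -- and cancelled below.
  rearrange : s ℤ.* + (t * a) ≡ s ℤ.* + a ℤ.* + t
  rearrange = trans (cong (λ n → s ℤ.* + n) (ℕ.*-comm t a)) (sym (ℤ.*-assoc s (+ a) (+ t)))
  sa<1+Tt : s ℤ.* + a ℤ.< + suc (T * t)
  sa<1+Tt = ℤ.*-cancelʳ-<-nonNeg (+ t) (subst (ℤ._< + suc (T * t) ℤ.* + t) rearrange
    (ℚᵘ.drop-*<* (ℚᵘ.<-respʳ-≃ (fraction-+ x T t a x≃T/a) (ℚ.toℚᵘ-mono-< q<x+1/ta))))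

-- Irrationality.

eₐ-irrational : Irrational eₐ
eₐ-irrational q eₐ≃q with partialSum-fraction (2 ^ ↧ₙ q)
... | T , S≃T/a = no-fraction-between S T a q {{n!ₐ≢0 n}} {{ta≢0}} S≃T/a S<q q<S+1/ta
  where
  open ℚ.≤-Reasoning
  t = ↧ₙ q
  n = 2 ^ t
  a = n !ₐ
  S = partialSum (suc n)
  instance
    ta≢0 : NonZero (t * a)
    ta≢0 = ℕ.m*n≢0 t a {{_}} {{n!ₐ≢0 n}}
    2ta≢0 : NonZero (2 * (t * a))
    2ta≢0 = ℕ.m*n≢0 2 (t * a)

  2ta<[1+n]!ₐ : 2 * (t * a) ℕ.< suc n !ₐ
  -- Since `n` is `2 ^ t`, the choice `k = t` yields the factor `2 * n`, and `t < 2 ^ t` makes it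
  -- exceed `2 * t`.
  2ta<[1+n]!ₐ = ℕ.<-≤-trans
    (ℕ.*-monoʳ-< 2 (ℕ.*-monoˡ-< a {{n!ₐ≢0 n}} (n<2^n t)))
    (ℕ.≤-trans (ℕ.≤-reflexive (sym (ℕ.*-assoc 2 n a)))
      (∣⇒≤ {{n!ₐ≢0 (suc n)}} (2^[1+k]*n!ₐ∣[1+n]!ₐ n t {{ℕ.m^n≢0 2 t}} ∣-refl)))

  S<q : S < q
  -- One further positive term makes the bound strict, as passing to the limit preserves only weak
  -- inequalities.
  S<q = begin-strict
    S                     ≡⟨ ℚ.+-identityʳ S ⟨
    S + 0ℚ                <⟨ ℚ.+-monoʳ-< S (ℚ.positive⁻¹ _ {{ℚ.normalize-pos 1 (suc n !ₐ) {{n!ₐ≢0 (suc n)}}}}) ⟩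
    partialSum (2 ℕ.+ n)  ≤⟨ ≃-lower eₐ {N = 2 ℕ.+ n} (λ _ 2+n≤m → partialSum-mono (ℕ.≤⇒≤′ 2+n≤m)) eₐ≃q ⟩
    q                     ∎

  1/[1+n]!ₐ<1/2ta : 1/ suc n !ₐ < + 1 / (2 * (t * a))
  1/[1+n]!ₐ<1/2ta = 1/-anti-< {{2ta≢0}} {{n!ₐ≢0 (suc n)}} 2ta<[1+n]!ₐ

  q<S+1/ta : q < S + + 1 / (t * a)
  q<S+1/ta = begin-strict
    q                                                    ≤⟨ ≃-upper eₐ (λ _ → partialSum≤tailBound {suc n}) eₐ≃q ⟩
    S + (1/ suc n !ₐ + 1/ suc n !ₐ)                      <⟨ ℚ.+-monoʳ-< S (ℚ.+-mono-< 1/[1+n]!ₐ<1/2ta 1/[1+n]!ₐ<1/2ta) ⟩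
    S + (+ 1 / (2 * (t * a)) + + 1 / (2 * (t * a)))      ≡⟨ cong (λ h → S + h) (1/-double (t * a)) ⟩
    S + + 1 / (t * a)                                    ∎

-- Numerical value.

-- Eleven terms suffice: 1/11!ₐ < 3 · 10⁻¹².
corollary26 : Irrational eₐ × (eₐ ≈ (+ 2562760934 / 10 ^ 9) ± (+ 1 / (2 * 10 ^ 9)))
corollary26 = eₐ-irrational , (ε , 0<ε , 11 , below) , (ε , 0<ε , 11 , above)
  where
  -- `_<ℝ_` demands a uniform positive gap; this one is small enough for both comparisons, which are
  -- decided by computation at index 11.
  ε = + 1 / 10 ^ 12
  centre = + 2562760934 / 10 ^ 9
  radius = + 1 / (2 * 10 ^ 9)
  0<ε : 0ℚ < ε
  0<ε = toWitness {a? = 0ℚ ℚ.<? ε} _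
  below : ∀ n → 11 ℕ.≤ n → centre - radius + ε < partialSum n
  below n 11≤n = ℚ.<-≤-trans
    (toWitness {a? = centre - radius + ε ℚ.<? partialSum 11} _)
    (partialSum-mono (ℕ.≤⇒≤′ 11≤n))
  above : ∀ n → 11 ℕ.≤ n → partialSum n + ε < centre + radius
  above n 11≤n = ℚ.≤-<-trans
    (ℚ.+-monoˡ-≤ ε (partialSum≤tailBound 11≤n))
    (toWitness {a? = tailBound 11 + ε ℚ.<? centre + radius} _)
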